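{- Every poset learning algorithm needs an expected number of at least $n^2/4-o(n^2)$ pairwise comparisons. Precisely: there is a function $g:\{1,2,3,\dots\}\to\mathbb{R}$ with $g(n)/n^2\to 0$ as $n\to\infty$ such that for every poset learning algorithm $\phi$ and every $n\ge 1$, $$e_\phi(n)\ \ge\ \frac{n^2}{4}-g(n).$$
   Context: For an integer $n\ge 1$, identify $n$ with the set $\{0,1,\dots,n-1\}$, and let $\mathcal P(n)$ be the set of all strict partial orders (irreflexive, transitive relations) $P\subseteq n\times n$ on this (labelled) set. For $P\in\mathcal P(n)$ and distinct $a,b\in n$, the pairwise comparison $\{a,b\}$ in $P$ reveals which one of the following holds: $a\,P\,b$, or $b\,P\,a$, or neither. A poset learning algorithm $\phi$ is a deterministic procedure which, given $n\ge 1$ and an unknown $P\in\mathcal P(n)$, obtains information about $P$ only by performing pairwise comparisons in $P$ one after another. The next pair to be compared may depend on $n$ and on the results of the previous comparisons. The procedure continues until $P$ is known, i.e. until $P$ is the only element of $\mathcal P(n)$ consistent with all the results obtained (so for each fixed $n$, $\phi$ is a ternary decision tree that identifies every $P\in\mathcal P(n)$). Let $c_\phi(P)$ be the number of pairwise comparisons that $\phi$ performs until it knows $P$. The expected number of comparisons is $$e_\phi(n):=\frac{1}{|\mathcal P(n)|}\sum_{P\in\mathcal P(n)}c_\phi(P).$$ -}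

module Defs where

open import Data.Bool using (Bool; true; false; T; if_then_else_)
open import Data.Bool.Properties using (T?)
open import Data.Fin using (Fin)
open import Data.Fin.Properties using (all?)
open import Data.Integer using (+_; 1ℤ)
open import Data.List using (List; []; _∷_; length; map; filter; cartesianProductWith)
open import Data.List.Membership.Propositional using (_∈_)
open import Data.List.Membership.Propositional.Properties using (∈-cartesianProductWith⁺; ∈-filter⁺; ∈-filter⁻; ∈-length)
open import Data.List.Relation.Unary.All using (All; []; _∷_)
open import Data.List.Relation.Unary.AllPairs using ([]; _∷_)
open import Data.List.Relation.Unary.Any using (here; there)
open import Data.List.Relation.Unary.Unique.Propositional using (Unique)
open import Data.List.Relation.Unary.Unique.Propositional.Properties using (cartesianProductWith⁺; filter⁺)
open import Data.Nat using (ℕ; zero; suc; NonZero; >-nonZero)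
import Data.Nat as ℕ
open import Data.Nat.ListAction using (sum)
open import Data.Nat.Properties using (m*n≢0)
open import Data.Product using (_×_; _,_; proj₂; ∃-syntax)
open import Data.Rational using (ℚ; 0ℚ; _/_; _*_; _<_; ∣_∣)
open import Data.Vec using (Vec; []; _∷_; lookup; replicate)
open import Data.Vec.Properties using (lookup-replicate; ∷-injective)
open import Function using (_⇔_; mk⇔; Equivalence)
open import Relation.Binary.PropositionalEquality using (_≡_; _≢_; refl; subst; cong; trans; isEquivalence; resp₂)
open import Relation.Binary.Structures using (IsStrictPartialOrder)
open import Relation.Nullary using (¬_; Dec; contradiction)
open import Relation.Nullary.Decidable using (map′; _×-dec_; _→-dec_; ¬?)

-- Relations on {0,…,n-1} are Boolean matrices, so that _≡_ is extensional
-- equality of relations.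
Relation : ℕ → Set
Relation n = Vec (Vec Bool n) n

entry : ∀ {n} → Relation n → Fin n → Fin n → Bool
entry P a b = lookup (lookup P a) b

Holds : ∀ {n} → Relation n → Fin n → Fin n → Set
Holds P a b = T (entry P a b)

IsPoset : ∀ {n} → Relation n → Set
IsPoset P = IsStrictPartialOrder _≡_ (Holds P)

isPoset? : ∀ {n} (P : Relation n) → Dec (IsPoset P)
isPoset? P = map′
  (λ (irr , tr) → record
    { isEquivalence = isEquivalence
    ; irrefl        = λ { {a} refl → irr a }
    ; trans         = λ {a} {b} {c} → tr a b c
    ; <-resp-≈      = resp₂ (Holds P)
    })
  (λ spo → let module S = IsStrictPartialOrder spo in
    (λ a → S.irrefl refl) , (λ a b c → S.trans))
  (all? (λ a → ¬? (T? (entry P a a)))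
    ×-dec
   all? (λ a → all? (λ b → all? (λ c →
     T? (entry P a b) →-dec (T? (entry P b c) →-dec T? (entry P a c))))))

vectors : ∀ {A : Set} → List A → (n : ℕ) → List (Vec A n)
vectors xs zero    = [] ∷ []
vectors xs (suc n) = cartesianProductWith _∷_ xs (vectors xs n)

relations : (n : ℕ) → List (Relation n)
relations n = vectors (vectors (true ∷ false ∷ []) n) n

-- The set 𝒫(n), as a list without repetitions (see ∈-posets and
-- posets-unique).
posets : (n : ℕ) → List (Relation n)
posets n = filter isPoset? (relations n)

∈-vectors : ∀ {A : Set} {xs : List A} → (∀ x → x ∈ xs) →
            ∀ {n} (v : Vec A n) → v ∈ vectors xs n
∈-vectors full []      = here refl
∈-vectors full (x ∷ v) = ∈-cartesianProductWith⁺ _∷_ (full x) (∈-vectors full v)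

vectors-unique : ∀ {A : Set} {xs : List A} → Unique xs →
                 ∀ n → Unique (vectors xs n)
vectors-unique u zero    = [] ∷ []
vectors-unique u (suc n) = cartesianProductWith⁺ _∷_ ∷-injective u (vectors-unique u n)

∈-bools : ∀ b → b ∈ true ∷ false ∷ []
∈-bools true  = here refl
∈-bools false = there (here refl)

∈-posets : ∀ {n} {P : Relation n} → (P ∈ posets n) ⇔ IsPoset P
∈-posets {n} {P} = mk⇔
  (λ P∈ → proj₂ (∈-filter⁻ isPoset? {xs = relations n} P∈))
  (∈-filter⁺ isPoset? (∈-vectors (∈-vectors ∈-bools) P))

posets-unique : ∀ n → Unique (posets n)
posets-unique n = filter⁺ isPoset?
  (vectors-unique (vectors-unique (((λ ()) ∷ []) ∷ [] ∷ []) n) n)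

antichain : ∀ n → Relation n
antichain n = replicate n (replicate n false)

antichain-isPoset : ∀ n → IsPoset (antichain n)
antichain-isPoset n = record
  { isEquivalence = isEquivalence
  ; irrefl        = λ {a} {b} _ → none a b
  ; trans         = λ {a} {b} a<b _ → contradiction a<b (none a b)
  ; <-resp-≈      = resp₂ (Holds (antichain n))
  }
  where
  entry-false : ∀ a b → entry (antichain n) a b ≡ false
  entry-false a b = trans (cong (λ r → lookup r b) (lookup-replicate a (replicate n false)))
                          (lookup-replicate b false)

  none : ∀ a b → ¬ Holds (antichain n) a b
  none a b = subst T (entry-false a b)

∣posets∣-nonZero : ∀ n → NonZero (length (posets n))
∣posets∣-nonZero n = >-nonZero (∈-length
  (Equivalence.from (∈-posets {P = antichain n}) (antichain-isPoset n)))

data Outcome : Set where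
  below above incomparable : Outcome

-- The result of comparing {a,b} in P: a P b, or b P a, or neither.  (The first
-- two cases exclude each other when P is a strict partial order.)
outcome : ∀ {n} → Relation n → Fin n → Fin n → Outcome
outcome P a b =
  if entry P a b then below else
  if entry P b a then above else
  incomparable

History : ℕ → Set
History n = List (Fin n × Fin n × Outcome)

Consistent : ∀ {n} → Relation n → History n → Set
Consistent P = All (λ (a , b , r) → outcome P a b ≡ r)

-- At most one element of 𝒫(n) is consistent with the results in h.  When h was
-- produced by some P ∈ 𝒫(n), this says that P is the only consistent one.
Known : ∀ {n} → History n → Set
Known {n} h = (P Q : Relation n) → IsPoset P → IsPoset Q →
              Consistent P h → Consistent Q h → P ≡ Q

-- A ternary decision tree, from the point at which the results in h have been
-- obtained: it stops exactly when the unknown poset is known.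
data Procedure (n : ℕ) (h : History n) : Set where
  stop    : Known h → Procedure n h
  compare : ¬ Known h → (a b : Fin n) → a ≢ b →
            ((r : Outcome) → Procedure n ((a , b , r) ∷ h)) → Procedure n h

PosetLearningAlgorithm : Set
PosetLearningAlgorithm = (n : ℕ) → .{{NonZero n}} → Procedure n []

comparisons : ∀ {n h} → Procedure n h → Relation n → ℕ
comparisons (stop _)             P = 0
comparisons (compare _ a b _ ψ) P = suc (comparisons (ψ (outcome P a b)) P)

cost : PosetLearningAlgorithm → (n : ℕ) → .{{NonZero n}} → Relation n → ℕ
cost φ n P = comparisons (φ n) P

expectedCost : PosetLearningAlgorithm → (n : ℕ) → .{{NonZero n}} → ℚ
expectedCost φ n =
  _/_ (+ sum (map (cost φ n) (posets n))) (length (posets n)) {{∣posets∣-nonZero n}}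

-- Functions on {1,2,3,…}.
Sequence : Set
Sequence = (n : ℕ) → .{{NonZero n}} → ℚ

TendsToZero : Sequence → Set
TendsToZero f = (ε : ℚ) → 0ℚ < ε →
  ∃[ N ] ((n : ℕ) → .{{_ : NonZero n}} → N ℕ.≤ n → ∣ f n ∣ < ε)

_/n² : Sequence → Sequence
(g /n²) n = g n * (_/_ 1ℤ (n ℕ.* n) {{m*n≢0 n n}})

{-# OPTIONS --safe #-}

-- Label every element a of a poset by the number of elements below it.  The
-- labels increase strictly along the order, so once the labelling is given, a
-- comparison has only two possible results and a learning procedure is a binary
-- decision tree on the posets with that labelling.  There are at most (n + 1)^n
-- labellings, costing only O(n log n) bits, and at least 2^⌊n²/4⌋ posets, since
-- every bipartite relation is one.  As the average depth of a leaf in a binary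
-- tree is at least the binary logarithm of the number of leaves, the average
-- cost is at least n²/4 - O(n log n).
module Submission where

open import Defs
open import Data.Bool using (Bool; true; false)
open import Data.Bool.Properties using (T-≡)
open import Data.Fin using (Fin; toℕ; fromℕ<; splitAt)
import Data.Fin.Properties as Fin
open import Data.Fin.Subset using (Subset; _∈_; ∣_∣)
open import Data.Fin.Subset.Properties using (∣p∣≤n; p⊂q⇒∣p∣<∣q∣)
open import Data.Integer using (+_)
import Data.Integer as ℤ
import Data.Integer.Properties as ℤ
open import Data.List using (List; []; _∷_; _++_; length; map; filter; allFin; cartesianProductWith)
open import Data.List.Membership.Propositional using () renaming (_∈_ to _∈ₗ_)
open import Data.List.Membership.Propositional.Properties using (∈-allFin; ∈-map⁻; ∈-∃++; ∈-++⁻; ∈-++⁺ˡ; ∈-++⁺ʳ)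
open import Data.List.Properties using (length-map; length-++; map-++; length-tabulate)
open import Data.List.Relation.Binary.Permutation.Propositional using (_↭_; ↭-refl; ↭-sym; ↭-trans; prep)
open import Data.List.Relation.Binary.Permutation.Propositional.Properties using (map⁺; shift; ↭-length)
open import Data.List.Relation.Unary.All as All using (All; []; _∷_)
import Data.List.Relation.Unary.All.Properties as All
open import Data.List.Relation.Unary.AllPairs using ([]; _∷_)
open import Data.List.Relation.Unary.Any using (here; there)
open import Data.List.Relation.Unary.Unique.Propositional using (Unique)
import Data.List.Relation.Unary.Unique.Propositional.Properties as Unique
open import Data.Nat using (ℕ; zero; suc; NonZero; _+_; _*_; _∸_; _^_; _≤_; _<_; z≤n; s≤s; ⌊_/2⌋; ⌈_/2⌉)
open import Data.Nat.Induction using (<-wellFounded)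
open import Data.Nat.ListAction using (sum)
open import Data.Nat.ListAction.Properties using (sum-↭; sum-++)
open import Data.Nat.Logarithm using (⌊log₂_⌋)
open import Data.Nat.Logarithm.Core using (⌊log2⌋)
open import Data.Nat.Properties
open import Data.Nat.Tactic.RingSolver using (solve-∀)
open import Data.Product using (Σ-syntax; ∃-syntax; _×_; _,_; proj₁; proj₂)
open import Data.Rational using (_/_; _-_; _≥_)
import Data.Rational as ℚ
import Data.Rational.Properties as ℚ
open import Data.Rational.Unnormalised as ℚᵘ using (mkℚᵘ; *≤*; *<*; *≡*)
import Data.Rational.Unnormalised.Properties as ℚᵘ
open import Data.Sum using (inj₁; inj₂)
open import Data.Vec as Vec using (Vec; lookup; replicate; tabulate)
open import Data.Vec.Properties using (lookup∘tabulate; []=⇒lookup; lookup⇒[]=; ≡-dec; lookup-splitAt; lookup-map; lookup-replicate; ∷-injective; ++-injectiveˡ; ++-injectiveʳ)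
open import Function using (_∘_; Equivalence; Injective)
open import Induction.WellFounded using (Acc; acc)
open import Level using (0ℓ)
open import Relation.Binary.PropositionalEquality
import Relation.Binary.Reasoning.Setoid as ≈-Reasoning
open import Relation.Binary.Structures using (IsStrictPartialOrder)
open import Relation.Nullary using (¬_; Dec; yes; no; contradiction; ¬?)
open import Relation.Unary using (Pred; Decidable)

-- Splitting, summing and counting finite lists

private
  variable
    A B : Set

filter-++-↭ : ∀ {P : Pred A 0ℓ} (P? : Decidable P) xs →
              xs ↭ filter P? xs ++ filter (¬? ∘ P?) xs
filter-++-↭ P? []       = ↭-refl
filter-++-↭ P? (x ∷ xs) with P? x
... | yes _ = prep x (filter-++-↭ P? xs)
... | no  _ = ↭-trans (prep x (filter-++-↭ P? xs)) (↭-sym (shift x (filter P? xs) _))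

length-filter-+ : ∀ {P : Pred A 0ℓ} (P? : Decidable P) xs →
                  length xs ≡ length (filter P? xs) + length (filter (¬? ∘ P?) xs)
length-filter-+ P? xs = trans (↭-length (filter-++-↭ P? xs)) (length-++ (filter P? xs))

sum-filter-+ : ∀ {P : Pred A 0ℓ} (P? : Decidable P) (f : A → ℕ) xs →
               sum (map f xs) ≡ sum (map f (filter P? xs)) + sum (map f (filter (¬? ∘ P?) xs))
sum-filter-+ P? f xs = begin
  sum (map f xs)                      ≡⟨ sum-↭ (map⁺ f (filter-++-↭ P? xs)) ⟩
  sum (map f (ys ++ zs))              ≡⟨ cong sum (map-++ f ys zs) ⟩
  sum (map f ys ++ map f zs)          ≡⟨ sum-++ (map f ys) (map f zs) ⟩
  sum (map f ys) + sum (map f zs)     ∎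
  where
  open ≡-Reasoning
  ys = filter P? xs
  zs = filter (¬? ∘ P?) xs

-- Serves to charge the comparison made at a node once to every poset that passes through it.
sum-map-suc : ∀ {f g : A → ℕ} {xs} → All (λ x → f x ≡ suc (g x)) xs →
              sum (map f xs) ≡ length xs + sum (map g xs)
sum-map-suc []                         = refl
sum-map-suc {g = g} {x ∷ xs} (eq ∷ es) rewrite eq | sum-map-suc es =
  cong suc (lemma (g x) (length xs) (sum (map g xs)))
  where
  lemma : ∀ a b c → a + (b + c) ≡ b + (a + c)
  lemma = solve-∀

-- By induction, removing the head of `xs` from `ys`: by uniqueness the head does not recur, so the
-- tail of `xs` stays inside what remains.
Unique⇒length≤ : {xs ys : List A} → Unique xs → (∀ {x} → x ∈ₗ xs → x ∈ₗ ys) →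
                 length xs ≤ length ys
Unique⇒length≤ []                _  = z≤n
Unique⇒length≤ {xs = x ∷ xs} (x∉ ∷ u) xs⊆ with ∈-∃++ (xs⊆ (here refl))
... | ys , zs , refl = begin
  suc (length xs)         ≤⟨ s≤s (Unique⇒length≤ u xs⊆′) ⟩
  suc (length (ys ++ zs)) ≡⟨ ↭-length (shift x ys zs) ⟨
  length (ys ++ x ∷ zs)   ∎
  where
  open ≤-Reasoning
  xs⊆′ : ∀ {y} → y ∈ₗ xs → y ∈ₗ ys ++ zs
  xs⊆′ y∈ with ∈-++⁻ ys (xs⊆ (there y∈))
  ... | inj₁ y∈ys         = ∈-++⁺ˡ y∈ys
  ... | inj₂ (here refl)  = contradiction refl (All.lookup x∉ y∈)
  ... | inj₂ (there y∈zs) = ∈-++⁺ʳ ys y∈zs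

length-cartesianProductWith : ∀ {C : Set} (f : A → B → C) xs ys →
  length (cartesianProductWith f xs ys) ≡ length xs * length ys
length-cartesianProductWith f []       ys = refl
length-cartesianProductWith f (x ∷ xs) ys
  rewrite length-++ (map (f x) ys) {cartesianProductWith f xs ys} | length-map (f x) ys
  = cong (λ x → length ys + x) (length-cartesianProductWith f xs ys)

length-vectors : ∀ (xs : List A) n → length (vectors xs n) ≡ length xs ^ n
length-vectors xs zero    = refl
length-vectors xs (suc n) = trans (length-cartesianProductWith Vec._∷_ xs (vectors xs n))
                                  (cong (length xs *_) (length-vectors xs n))

1+n≤2^n : ∀ n → suc n ≤ 2 ^ n
1+n≤2^n zero    = s≤s z≤n
1+n≤2^n (suc n) = begin
  suc (suc n)   ≡⟨ +-comm 1 (suc n) ⟩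
  suc n + 1     ≤⟨ +-mono-≤ (1+n≤2^n n) (m^n>0 2 n) ⟩
  2 ^ n + 2 ^ n ≡⟨ cong (λ x → 2 ^ n + x) (+-identityʳ (2 ^ n)) ⟨
  2 ^ suc n     ∎
  where open ≤-Reasoning

-- Decision trees under a known labelling

Respects : ∀ {n} → (Fin n → ℕ) → Relation n → Set
Respects ℓ P = ∀ {a b} → Holds P a b → ℓ a < ℓ b

incomparable? : ∀ r → Dec (r ≡ incomparable)
incomparable? below        = no λ ()
incomparable? above        = no λ ()
incomparable? incomparable = yes refl

-- Knowing ℓ in advance leaves only two possible results of each comparison.
comparableOutcome : ∀ {n} (ℓ : Fin n → ℕ) (a b : Fin n) → ∃[ r ]
  (∀ P → Respects ℓ P → outcome P a b ≢ incomparable → outcome P a b ≡ r)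
comparableOutcome ℓ a b with ℓ a <? ℓ b
... | yes ℓa<ℓb = below , is-below
  where
  is-below : ∀ P → Respects ℓ P → outcome P a b ≢ incomparable → outcome P a b ≡ below
  is-below P resp comparable with entry P a b | entry P b a in b<a
  ... | true  | _     = refl
  ... | false | true  = contradiction (resp (Equivalence.from T-≡ b<a)) (<-asym ℓa<ℓb)
  ... | false | false = contradiction refl comparable
... | no ℓa≮ℓb = above , is-above
  where
  is-above : ∀ P → Respects ℓ P → outcome P a b ≢ incomparable → outcome P a b ≡ above
  is-above P resp comparable with entry P a b in a<b | entry P b a
  ... | true  | _     = contradiction (resp (Equivalence.from T-≡ a<b)) ℓa≮ℓb
  ... | false | true  = refl
  ... | false | false = contradiction refl comparable

-- The invariant on the posets at a node of the tree. About `ℓ` it records strict monotonicity,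
-- rather than that `ℓ` is the labelling of `P`: monotonicity is what fixes the direction of every
-- comparable pair.
record Candidate {n} (ℓ : Fin n → ℕ) (h : History n) (P : Relation n) : Set where
  constructor candidate
  field
    isPoset    : IsPoset P
    respects   : Respects ℓ P
    consistent : Consistent P h

known⇒length≤1 : ∀ {n} {ℓ : Fin n → ℕ} {h S} → Known h → Unique S →
                 All (Candidate ℓ h) S → length S ≤ 1
known⇒length≤1 known []       []       = z≤n
known⇒length≤1 known (_ ∷ []) (_ ∷ []) = s≤s z≤n
known⇒length≤1 known ((P≢Q ∷ _) ∷ _) (candidate p _ cp ∷ candidate q _ cq ∷ _) =
  contradiction (known _ _ p q cp cq) P≢Q

-- Summing 2^(k - c) ≥ 1 + (k - c) over the leaves of a binary tree and using
-- Kraft's inequality, but with all terms moved so that no subtraction occurs.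
kraft : ∀ {n h} (ℓ : Fin n → ℕ) (t : Procedure n h) k {S} → Unique S →
        All (Candidate ℓ h) S →
        length S * suc k ≤ 2 ^ k + sum (map (comparisons t) S)
kraft ℓ t@(stop known) k {S} u cand = begin
  length S * suc k                                   ≤⟨ *-monoˡ-≤ (suc k) (known⇒length≤1 known u cand) ⟩
  1 * suc k                                          ≡⟨ *-identityˡ (suc k) ⟩
  suc k                                              ≤⟨ 1+n≤2^n k ⟩
  2 ^ k                                              ≤⟨ m≤m+n (2 ^ k) _ ⟩
  2 ^ k + sum (map (comparisons t) S)                ∎
  where open ≤-Reasoning
-- The depth allowance `k` can run out above a leaf. Each poset in `S` then still costs one
-- comparison here, and this pays for the left-hand side.
kraft ℓ t@(compare _ a b _ ψ) zero {S} u cand = begin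
  length S * 1                        ≡⟨ *-identityʳ (length S) ⟩
  length S                            ≤⟨ m≤m+n (length S) _ ⟩
  length S + sum (map rest S)         ≡⟨ sum-map-suc {f = comparisons t} (All.universal (λ _ → refl) S) ⟨
  sum (map (comparisons t) S)         ≤⟨ m≤n+m _ 1 ⟩
  1 + sum (map (comparisons t) S)     ∎
  where
  open ≤-Reasoning
  rest : Relation _ → ℕ
  rest P = comparisons (ψ (outcome P a b)) P
kraft {n} {h} ℓ t@(compare _ a b _ ψ) (suc k) {S} u cand = begin
  length S * suc (suc k)
    ≡⟨ cong (_* suc (suc k)) (length-filter-+ inc? S) ⟩
  (length S₀ + length S₁) * suc (suc k)
    ≡⟨ expand (length S₀) (length S₁) (suc k) ⟩
  (length S₀ * suc k + length S₀) + (length S₁ * suc k + length S₁)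
    -- All comparable posets follow the single branch `ψ r`, so two subtrees with allowance `k`
    -- share `2 ^ suc k`. The spare terms `length S₀` and `length S₁` pay for the comparison at this
    -- node.
    ≤⟨ +-mono-≤ (+-monoˡ-≤ (length S₀) (kraft ℓ (ψ incomparable) k (Unique.filter⁺ inc? u) cand₀))
                (+-monoˡ-≤ (length S₁) (kraft ℓ (ψ r) k (Unique.filter⁺ (¬? ∘ inc?) u) cand₁)) ⟩
  (2 ^ k + σ₀ + length S₀) + (2 ^ k + σ₁ + length S₁)
    ≡⟨ collect (2 ^ k) σ₀ σ₁ (length S₀) (length S₁) ⟩
  2 ^ suc k + ((length S₀ + σ₀) + (length S₁ + σ₁))
    ≡⟨ cong₂ (λ x y → 2 ^ suc k + (x + y)) (sum-map-suc (All.map step results₀))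
                                           (sum-map-suc (All.map step results₁)) ⟨
  2 ^ suc k + (sum (map (comparisons t) S₀) + sum (map (comparisons t) S₁))
    ≡⟨ cong (λ x → 2 ^ suc k + x) (sum-filter-+ inc? (comparisons t) S) ⟨
  2 ^ suc k + sum (map (comparisons t) S) ∎
  where
  open ≤-Reasoning
  inc? : Decidable (λ P → outcome P a b ≡ incomparable)
  inc? P = incomparable? (outcome P a b)
  S₀ = filter inc? S
  S₁ = filter (¬? ∘ inc?) S
  r = proj₁ (comparableOutcome ℓ a b)
  σ₀ = sum (map (comparisons (ψ incomparable)) S₀)
  σ₁ = sum (map (comparisons (ψ r)) S₁)

  results₀ : All (λ P → outcome P a b ≡ incomparable) S₀
  results₀ = All.all-filter inc? S

  results₁ : All (λ P → outcome P a b ≡ r) S₁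
  results₁ = All.zipWith (λ {P} (c , comparable) →
                            proj₂ (comparableOutcome ℓ a b) P (Candidate.respects c) comparable)
                         (All.filter⁺ (¬? ∘ inc?) cand , All.all-filter (¬? ∘ inc?) S)

  extend : ∀ {s P} → Candidate ℓ h P × outcome P a b ≡ s → Candidate ℓ ((a , b , s) ∷ h) P
  extend (candidate isP resp cons , eq) = candidate isP resp (eq ∷ cons)

  cand₀ : All (Candidate ℓ ((a , b , incomparable) ∷ h)) S₀
  cand₀ = All.zipWith extend (All.filter⁺ inc? cand , results₀)

  cand₁ : All (Candidate ℓ ((a , b , r) ∷ h)) S₁
  cand₁ = All.zipWith extend (All.filter⁺ (¬? ∘ inc?) cand , results₁)

  step : ∀ {s P} → outcome P a b ≡ s → comparisons t P ≡ suc (comparisons (ψ s) P)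
  step refl = refl

  expand : ∀ x y k → (x + y) * suc k ≡ (x * k + x) + (y * k + y)
  expand = solve-∀

  collect : ∀ p x y u v → (p + x + u) + (p + y + v) ≡ 2 * p + ((u + x) + (v + y))
  collect = solve-∀

-- Labelling by the sizes of down-sets

down : ∀ {n} → Relation n → Fin n → Subset n
down P a = tabulate (λ b → entry P b a)

∈-down⁺ : ∀ {n} (P : Relation n) {a b} → Holds P b a → b ∈ down P a
∈-down⁺ P {a} {b} b<a = lookup⇒[]= b (down P a)
  (trans (lookup∘tabulate (λ b → entry P b a) b) (Equivalence.to T-≡ b<a))

∈-down⁻ : ∀ {n} (P : Relation n) {a b} → b ∈ down P a → Holds P b a
∈-down⁻ P {a} {b} b∈ = Equivalence.from T-≡
  (trans (sym (lookup∘tabulate (λ b → entry P b a) b)) ([]=⇒lookup b∈))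

-- Transitivity gives the inclusion of down-sets. It is proper because `a` lies below `b` but, by
-- irreflexivity, not below itself.
∣down∣-mono : ∀ {n} (P : Relation n) → IsPoset P → Respects (λ a → ∣ down P a ∣) P
∣down∣-mono P isP {a} {b} a<b = p⊂q⇒∣p∣<∣q∣
  ( (λ c∈ → ∈-down⁺ P (S.trans (∈-down⁻ P c∈) a<b))
  , a , ∈-down⁺ P a<b , (λ a∈ → S.irrefl refl (∈-down⁻ P a∈)) )
  where module S = IsStrictPartialOrder isP

-- Vectors over a finite type have decidable equality and can be enumerated by `vectors`; a down-set
-- has at most `n` elements, whence `suc n` possible labels.
Labelling : ℕ → Set
Labelling n = Vec (Fin (suc n)) n

labelling : ∀ {n} → Relation n → Labelling n
labelling P = tabulate (λ a → fromℕ< (s≤s (∣p∣≤n (down P a))))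

label : ∀ {n} → Labelling n → Fin n → ℕ
label ℓ a = toℕ (lookup ℓ a)

label-labelling : ∀ {n} (P : Relation n) a → label (labelling P) a ≡ ∣ down P a ∣
label-labelling P a = trans (cong toℕ (lookup∘tabulate _ a)) (Fin.toℕ-fromℕ< _)

labelling-respects : ∀ {n} (P : Relation n) → IsPoset P → Respects (label (labelling P)) P
labelling-respects P isP {a} {b} a<b =
  subst₂ _<_ (sym (label-labelling P a)) (sym (label-labelling P b)) (∣down∣-mono P isP a<b)

_≟ˡ_ : ∀ {n} (ℓ ℓ′ : Labelling n) → Dec (ℓ ≡ ℓ′)
_≟ˡ_ = ≡-dec Fin._≟_

-- The posets are sorted into classes by their labelling, and `kraft` is applied to each class with
-- the same tree `t`. Every labelling in `ℓs` thus contributes one term `2 ^ k`.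
kraft-labelled : ∀ {n} (t : Procedure n []) k (ℓs : List (Labelling n)) {S} → Unique S →
                 All IsPoset S → All (λ P → labelling P ∈ₗ ℓs) S →
                 length S * suc k ≤ length ℓs * 2 ^ k + sum (map (comparisons t) S)
kraft-labelled t k []       {[]} u isP ℓ∈       = z≤n
kraft-labelled t k []       u isP (() ∷ _)
kraft-labelled t k (ℓ ∷ ℓs) {S} u isP ℓ∈ = begin
  length S * suc k
    ≡⟨ cong (_* suc k) (length-filter-+ ℓ? S) ⟩
  (length S₀ + length S₁) * suc k
    ≡⟨ *-distribʳ-+ (suc k) (length S₀) (length S₁) ⟩
  length S₀ * suc k + length S₁ * suc k
    ≤⟨ +-mono-≤ (kraft (label ℓ) t k (Unique.filter⁺ ℓ? u) cand)
                (kraft-labelled t k ℓs (Unique.filter⁺ (¬? ∘ ℓ?) u) (All.filter⁺ (¬? ∘ ℓ?) isP) ℓ∈′) ⟩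
  (2 ^ k + σ S₀) + (length ℓs * 2 ^ k + σ S₁)
    ≡⟨ collect (2 ^ k) (length ℓs * 2 ^ k) (σ S₀) (σ S₁) ⟩
  suc (length ℓs) * 2 ^ k + (σ S₀ + σ S₁)
    ≡⟨ cong (λ x → suc (length ℓs) * 2 ^ k + x) (sum-filter-+ ℓ? (comparisons t) S) ⟨
  suc (length ℓs) * 2 ^ k + σ S ∎
  where
  open ≤-Reasoning
  ℓ? : Decidable (λ P → labelling P ≡ ℓ)
  ℓ? P = labelling P ≟ˡ ℓ
  S₀ = filter ℓ? S
  S₁ = filter (¬? ∘ ℓ?) S
  σ : List (Relation _) → ℕ
  σ = sum ∘ map (comparisons t)

  initial : ∀ P → IsPoset P × labelling P ≡ ℓ → Candidate (label ℓ) [] P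
  initial P (isP , refl) = candidate isP (labelling-respects P isP) []

  cand : All (Candidate (label ℓ) []) S₀
  cand = All.zipWith (λ {P} → initial P) (All.filter⁺ ℓ? isP , All.all-filter ℓ? S)

  drop-head : ∀ P → labelling P ∈ₗ ℓ ∷ ℓs × labelling P ≢ ℓ → labelling P ∈ₗ ℓs
  drop-head P (here eq  , ≢ℓ) = contradiction eq ≢ℓ
  drop-head P (there ∈ℓs , _) = ∈ℓs

  ℓ∈′ : All (λ P → labelling P ∈ₗ ℓs) S₁
  ℓ∈′ = All.zipWith (λ {P} → drop-head P) (All.filter⁺ (¬? ∘ ℓ?) ℓ∈ , All.all-filter (¬? ∘ ℓ?) S)

  collect : ∀ p q x y → (p + x) + (q + y) ≡ (p + q) + (x + y)
  collect = solve-∀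

kraft-posets : ∀ {n} (t : Procedure n []) k →
               length (posets n) * suc k ≤ suc n ^ n * 2 ^ k + sum (map (comparisons t) (posets n))
kraft-posets {n} t k =
  subst (λ m → length (posets n) * suc k ≤ m * 2 ^ k + sum (map (comparisons t) (posets n)))
    (trans (length-vectors (allFin (suc n)) n) (cong (_^ n) (length-tabulate {n = suc n} (λ i → i))))
    (kraft-labelled t k (vectors (allFin (suc n)) n) (posets-unique n)
      (All.tabulate (Equivalence.to ∈-posets))
      (All.universal (λ P → ∈-vectors ∈-allFin (labelling P)) (posets n)))

-- Counting bipartite posets

bipartite : ∀ h m → Vec (Vec Bool m) h → Relation (h + m)
bipartite h m M = Vec.map (replicate h false Vec.++_) M Vec.++ replicate m (replicate (h + m) false)

-- In block form the matrix has `M` in its upper right corner, and the three other blocks are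
-- constantly `false`.
bipartite-holds : ∀ h m M {a b} → Holds (bipartite h m M) a b →
                  (∃[ i ] splitAt h a ≡ inj₁ i) × (∃[ j ] splitAt h b ≡ inj₂ j)
bipartite-holds h m M {a} {b} a<b
  rewrite lookup-splitAt h (Vec.map (replicate h false Vec.++_) M) (replicate m (replicate (h + m) false)) a
  with splitAt h a
... | inj₂ j rewrite lookup-replicate j (replicate (h + m) false) | lookup-replicate b false = contradiction a<b λ ()
... | inj₁ i
  rewrite lookup-map i (replicate h false Vec.++_) M
        | lookup-splitAt h (replicate h false) (lookup M i) b
  with splitAt h b
... | inj₁ j rewrite lookup-replicate j false = contradiction a<b λ ()
... | inj₂ j = (i , refl) , (j , refl)

-- No element is in both the first and the second part, so no two related pairs can be chained.
-- Transitivity is vacuous, and a loop would chain with itself.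
bipartite-isPoset : ∀ h m M → IsPoset (bipartite h m M)
bipartite-isPoset h m M = record
  { isEquivalence = isEquivalence
  ; irrefl        = λ { refl a<a → no-middle a<a a<a }
  ; trans         = λ a<b b<c → contradiction b<c (no-middle a<b)
  ; <-resp-≈      = resp₂ (Holds (bipartite h m M))
  }
  where
  no-middle : ∀ {a b c} → Holds (bipartite h m M) a b → ¬ Holds (bipartite h m M) b c
  no-middle a<b b<c
    with (_ , upper) ← proj₂ (bipartite-holds h m M a<b)
       | (_ , lower) ← proj₁ (bipartite-holds h m M b<c)
    with () ← trans (sym lower) upper

map-injective : ∀ {f : A → B} {n} → Injective _≡_ _≡_ f → Injective _≡_ _≡_ (Vec.map {n = n} f)
map-injective f-inj {Vec.[]}     {Vec.[]}     _  = refl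
map-injective f-inj {x Vec.∷ xs} {y Vec.∷ ys} eq with ∷-injective eq
... | fx≡fy , fxs≡fys = cong₂ Vec._∷_ (f-inj fx≡fy) (map-injective f-inj fxs≡fys)

bipartite-injective : ∀ h m → Injective _≡_ _≡_ (bipartite h m)
bipartite-injective h m eq =
  map-injective (++-injectiveʳ (replicate h false) (replicate h false)) (++-injectiveˡ _ _ eq)

-- There are `2 ^ (m * h)` Boolean matrices of the block size, and `bipartite` sends distinct ones
-- to distinct posets.
2^hm≤∣posets∣ : ∀ h m → 2 ^ (m * h) ≤ length (posets (h + m))
2^hm≤∣posets∣ h m = begin
  2 ^ (m * h)                            ≡⟨ ^-*-assoc 2 m h ⟨
  (2 ^ m) ^ h                            ≡⟨ cong (_^ h) (length-vectors bools m) ⟨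
  length (vectors bools m) ^ h           ≡⟨ length-vectors (vectors bools m) h ⟨
  length matrices                        ≡⟨ length-map (bipartite h m) matrices ⟨
  length (map (bipartite h m) matrices)  ≤⟨ Unique⇒length≤ unique ⊆posets ⟩
  length (posets (h + m))                ∎
  where
  open ≤-Reasoning
  bools = true ∷ false ∷ []
  matrices = vectors (vectors bools m) h
  unique = Unique.map⁺ (bipartite-injective h m)
             (vectors-unique (vectors-unique (((λ ()) ∷ []) ∷ [] ∷ []) m) h)
  ⊆posets : ∀ {P} → P ∈ₗ map (bipartite h m) matrices → P ∈ₗ posets (h + m)
  ⊆posets P∈ with (M , _ , refl) ← ∈-map⁻ (bipartite h m) P∈ =
    Equivalence.from ∈-posets (bipartite-isPoset h m M)

-- This is ⌊n²/4⌋, written as the exponent that a balanced split into two parts yields.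
quarter : ℕ → ℕ
quarter n = ⌈ n /2⌉ * ⌊ n /2⌋

2^quarter≤∣posets∣ : ∀ n → 2 ^ quarter n ≤ length (posets n)
2^quarter≤∣posets∣ n = subst (λ k → 2 ^ quarter n ≤ length (posets k)) (⌊n/2⌋+⌈n/2⌉≡n n)
                         (2^hm≤∣posets∣ ⌊ n /2⌋ ⌈ n /2⌉)

-- Passing from `n` to `n + 2` adds `4 * n + 4` to both sides, since the two halves of `n` sum to
-- `n`. The `+ 1` is the rounding loss for odd `n`.
n²≤4*quarter+1 : ∀ n → n * n ≤ 4 * quarter n + 1
n²≤4*quarter+1 zero          = z≤n
n²≤4*quarter+1 (suc zero)    = s≤s z≤n
n²≤4*quarter+1 (suc (suc n)) = begin
  suc (suc n) * suc (suc n)                    ≡⟨ square n ⟩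
  n * n + 4 * n + 4                            ≤⟨ +-monoˡ-≤ 4 (+-monoˡ-≤ (4 * n) (n²≤4*quarter+1 n)) ⟩
  4 * (c * f) + 1 + 4 * n + 4                  ≡⟨ cong (λ x → 4 * (c * f) + 1 + 4 * x + 4) (⌊n/2⌋+⌈n/2⌉≡n n) ⟨
  4 * (c * f) + 1 + 4 * (f + c) + 4            ≡⟨ factor c f ⟩
  4 * (suc c * suc f) + 1                      ∎
  where
  open ≤-Reasoning
  c = ⌈ n /2⌉
  f = ⌊ n /2⌋
  square : ∀ n → suc (suc n) * suc (suc n) ≡ n * n + 4 * n + 4
  square = solve-∀
  factor : ∀ c f → 4 * (c * f) + 1 + 4 * (f + c) + 4 ≡ 4 * (suc c * suc f) + 1
  factor = solve-∀

-- Estimates for the binary logarithm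

2*⌊n/2⌋≤n : ∀ n → 2 * ⌊ n /2⌋ ≤ n
2*⌊n/2⌋≤n zero          = z≤n
2*⌊n/2⌋≤n (suc zero)    = z≤n
2*⌊n/2⌋≤n (suc (suc n)) = subst (_≤ suc (suc n)) (sym (*-suc 2 ⌊ n /2⌋)) (s≤s (s≤s (2*⌊n/2⌋≤n n)))

n<2*[1+⌊n/2⌋] : ∀ n → n < 2 * suc ⌊ n /2⌋
n<2*[1+⌊n/2⌋] zero          = s≤s z≤n
n<2*[1+⌊n/2⌋] (suc zero)    = s≤s (s≤s z≤n)
n<2*[1+⌊n/2⌋] (suc (suc n)) =
  subst (suc (suc n) <_) (sym (*-suc 2 (suc ⌊ n /2⌋))) (s≤s (s≤s (n<2*[1+⌊n/2⌋] n)))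

2^⌊log₂n⌋≤n : ∀ n .{{_ : NonZero n}} → 2 ^ ⌊log₂ n ⌋ ≤ n
2^⌊log₂n⌋≤n n = go n (<-wellFounded n)
  where
  -- The logarithm recurses on an accessibility proof; generalising over that proof lets the
  -- induction follow its halving steps.
  go : ∀ n .{{_ : NonZero n}} (rs : Acc _<_ n) → 2 ^ ⌊log2⌋ n rs ≤ n
  go (suc zero)    _        = s≤s z≤n
  go (suc (suc n)) (acc rs) = ≤-trans (*-monoʳ-≤ 2 (go (suc ⌊ n /2⌋) (rs _))) (2*⌊n/2⌋≤n (suc (suc n)))

n<2^[1+⌊log₂n⌋] : ∀ n → n < 2 ^ suc ⌊log₂ n ⌋
n<2^[1+⌊log₂n⌋] n = go n (<-wellFounded n)
  where
  go : ∀ n (rs : Acc _<_ n) → n < 2 ^ suc (⌊log2⌋ n rs)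
  go zero          _        = s≤s z≤n
  go (suc zero)    _        = s≤s (s≤s z≤n)
  go (suc (suc n)) (acc rs) =
    <-≤-trans (n<2*[1+⌊n/2⌋] (suc (suc n))) (*-monoʳ-≤ 2 (go (suc ⌊ n /2⌋) (rs _)))

-- From `n = 1` on, each step at most doubles the square. The first step, from 4 to 9, more than
-- doubles it, hence the second base case. The constant 9 covers both starting values at once.
[2+n]²≤9*2^n : ∀ n → (2 + n) * (2 + n) ≤ 9 * 2 ^ n
[2+n]²≤9*2^n zero          = m≤m+n 4 5
[2+n]²≤9*2^n (suc zero)    = m≤m+n 9 9
[2+n]²≤9*2^n (suc (suc n)) = begin
  (4 + n) * (4 + n)                    ≤⟨ m≤m+n _ (n * n + 4 * n + 2) ⟩
  (4 + n) * (4 + n) + (n * n + 4 * n + 2) ≡⟨ double n ⟩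
  2 * ((3 + n) * (3 + n))              ≤⟨ *-monoʳ-≤ 2 ([2+n]²≤9*2^n (suc n)) ⟩
  2 * (9 * 2 ^ suc n)                  ≡⟨ swap (2 ^ suc n) ⟩
  9 * 2 ^ suc (suc n)                  ∎
  where
  open ≤-Reasoning
  double : ∀ n → (4 + n) * (4 + n) + (n * n + 4 * n + 2) ≡ 2 * ((3 + n) * (3 + n))
  double = solve-∀
  swap : ∀ x → 2 * (9 * x) ≡ 9 * (2 * x)
  swap = solve-∀

-- An explicit threshold for log n / n → 0. Writing `l` for the first factor, `l * l` is at most
-- `9 * n`, so squaring `n ≤ l * d` would give `n * n ≤ 9 * n * (d * d) < n * n`.
2+⌊log₂⌋-sublinear : ∀ d n .{{_ : NonZero n}} → 9 * (d * d) < n → (2 + ⌊log₂ n ⌋) * d < n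
2+⌊log₂⌋-sublinear d n 9d²<n = ≰⇒> λ n≤ld → <-irrefl refl (begin-strict
  n * n                        ≤⟨ *-mono-≤ n≤ld n≤ld ⟩
  (l * d) * (l * d)            ≡⟨ regroup l d ⟩
  (l * l) * (d * d)            ≤⟨ *-monoˡ-≤ (d * d) ([2+n]²≤9*2^n ⌊log₂ n ⌋) ⟩
  9 * 2 ^ ⌊log₂ n ⌋ * (d * d)  ≤⟨ *-monoˡ-≤ (d * d) (*-monoʳ-≤ 9 (2^⌊log₂n⌋≤n n)) ⟩
  9 * n * (d * d)              ≡⟨ commute n (d * d) ⟩
  n * (9 * (d * d))            <⟨ *-monoʳ-< n 9d²<n ⟩
  n * n                        ∎)
  where
  open ≤-Reasoning
  l = 2 + ⌊log₂ n ⌋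
  regroup : ∀ l d → (l * d) * (l * d) ≡ (l * l) * (d * d)
  regroup = solve-∀
  commute : ∀ n x → 9 * n * x ≡ n * (9 * x)
  commute = solve-∀

-- Lower bound on the total cost

labellingBits : ℕ → ℕ
labellingBits n = suc ⌊log₂ n ⌋ * n

-- Every label from 0 to `n` fits into `suc ⌊log₂ n ⌋` binary digits.
[1+n]^n≤2^labellingBits : ∀ n → suc n ^ n ≤ 2 ^ labellingBits n
[1+n]^n≤2^labellingBits n = begin
  suc n ^ n                  ≤⟨ ^-monoˡ-≤ n (n<2^[1+⌊log₂n⌋] n) ⟩
  (2 ^ suc ⌊log₂ n ⌋) ^ n    ≡⟨ ^-*-assoc 2 (suc ⌊log₂ n ⌋) n ⟩
  2 ^ labellingBits n        ∎
  where open ≤-Reasoning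

-- The hypothesis on `k` keeps the Kraft term `suc n ^ n * 2 ^ k` below the number of posets, so it
-- cancels one of the `suc k` copies of that number.
totalCost≥ : ∀ {n} (t : Procedure n []) k → k + labellingBits n ≤ quarter n →
           k * length (posets n) ≤ sum (map (comparisons t) (posets n))
totalCost≥ {n} t k k+bits≤quarter = +-cancelˡ-≤ N (k * N) _ (begin
  N + k * N                    ≡⟨ *-comm (suc k) N ⟩
  N * suc k                    ≤⟨ kraft-posets t k ⟩
  suc n ^ n * 2 ^ k + σ        ≤⟨ +-monoˡ-≤ σ labels≤N ⟩
  N + σ                        ∎)
  where
  open ≤-Reasoning
  N = length (posets n)
  σ = sum (map (comparisons t) (posets n))
  labels≤N : suc n ^ n * 2 ^ k ≤ N
  labels≤N = begin
    suc n ^ n * 2 ^ k              ≤⟨ *-monoˡ-≤ (2 ^ k) ([1+n]^n≤2^labellingBits n) ⟩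
    2 ^ labellingBits n * 2 ^ k    ≡⟨ *-comm (2 ^ labellingBits n) (2 ^ k) ⟩
    2 ^ k * 2 ^ labellingBits n    ≡⟨ ^-distribˡ-+-* 2 k (labellingBits n) ⟨
    2 ^ (k + labellingBits n)      ≤⟨ ^-monoʳ-≤ 2 k+bits≤quarter ⟩
    2 ^ quarter n                  ≤⟨ 2^quarter≤∣posets∣ n ⟩
    N                              ∎

totalCost≥quarter∸bits : ∀ {n} (t : Procedure n []) →
  (quarter n ∸ labellingBits n) * length (posets n) ≤ sum (map (comparisons t) (posets n))
totalCost≥quarter∸bits {n} t with ≤-total (labellingBits n) (quarter n)
... | inj₁ bits≤quarter = totalCost≥ t (quarter n ∸ labellingBits n) (≤-reflexive (m∸n+n≡m bits≤quarter))
-- Truncated subtraction gives 0 here, and the bound is trivial.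
... | inj₂ quarter≤bits rewrite m≤n⇒m∸n≡0 quarter≤bits = z≤n

-- Fractions of natural numbers as rationals

toℚᵘ-/ : ∀ i d .{{_ : NonZero d}} → ℚ.toℚᵘ (i / d) ℚᵘ.≃ i ℚᵘ./ d
toℚᵘ-/ i (suc d) = ℚ.toℚᵘ-fromℚᵘ (mkℚᵘ i d)

-- Since `_/_` reduces to lowest terms, the comparison is moved to unnormalised fractions, whose
-- order is cross-multiplication by definition.
/-mono-≤ : ∀ a b c d .{{_ : NonZero b}} .{{_ : NonZero d}} →
           a * d ≤ c * b → + a / b ℚ.≤ + c / d
/-mono-≤ a b@(suc _) c d@(suc _) ad≤cb = ℚ.toℚᵘ-cancel-≤
  (ℚᵘ.≤-respˡ-≃ (ℚᵘ.≃-sym (toℚᵘ-/ (+ a) b)) (ℚᵘ.≤-respʳ-≃ (ℚᵘ.≃-sym (toℚᵘ-/ (+ c) d))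
    (*≤* (subst₂ ℤ._≤_ (ℤ.pos-* a d) (ℤ.pos-* c b) (ℤ.+≤+ ad≤cb)))))

/-mono-< : ∀ a b c d .{{_ : NonZero b}} .{{_ : NonZero d}} →
           a * d < c * b → + a / b ℚ.< + c / d
/-mono-< a b@(suc _) c d@(suc _) ad<cb = ℚ.toℚᵘ-cancel-<
  (ℚᵘ.<-respˡ-≃ (ℚᵘ.≃-sym (toℚᵘ-/ (+ a) b)) (ℚᵘ.<-respʳ-≃ (ℚᵘ.≃-sym (toℚᵘ-/ (+ c) d))
    (*<* (subst₂ ℤ._<_ (ℤ.pos-* a d) (ℤ.pos-* c b) (ℤ.+<+ ad<cb)))))

/1-homo-+ : ∀ a b → + (a + b) / 1 ≡ + a / 1 ℚ.+ + b / 1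
/1-homo-+ a b = ℚ.toℚᵘ-injective (begin
  ℚ.toℚᵘ (+ (a + b) / 1)                    ≈⟨ toℚᵘ-/ (+ (a + b)) 1 ⟩
  + (a + b) ℚᵘ./ 1                          ≈⟨ *≡* (cong (ℤ._* + 1) (sym (cong₂ ℤ._+_ (ℤ.*-identityʳ (+ a)) (ℤ.*-identityʳ (+ b))))) ⟩
  (+ a ℚᵘ./ 1) ℚᵘ.+ (+ b ℚᵘ./ 1)            ≈⟨ ℚᵘ.+-cong (toℚᵘ-/ (+ a) 1) (toℚᵘ-/ (+ b) 1) ⟨
  ℚ.toℚᵘ (+ a / 1) ℚᵘ.+ ℚ.toℚᵘ (+ b / 1)    ≈⟨ ℚ.toℚᵘ-homo-+ (+ a / 1) (+ b / 1) ⟨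
  ℚ.toℚᵘ (+ a / 1 ℚ.+ + b / 1)              ∎)
  where open ≈-Reasoning ℚᵘ.≃-setoid

a/1*1/d≡a/d : ∀ a d .{{_ : NonZero d}} → (+ a / 1) ℚ.* (+ 1 / d) ≡ + a / d
a/1*1/d≡a/d a d@(suc _) = ℚ.toℚᵘ-injective (begin
  ℚ.toℚᵘ ((+ a / 1) ℚ.* (+ 1 / d))          ≈⟨ ℚ.toℚᵘ-homo-* (+ a / 1) (+ 1 / d) ⟩
  ℚ.toℚᵘ (+ a / 1) ℚᵘ.* ℚ.toℚᵘ (+ 1 / d)    ≈⟨ ℚᵘ.*-cong (toℚᵘ-/ (+ a) 1) (toℚᵘ-/ (+ 1) d) ⟩
  (+ a ℚᵘ./ 1) ℚᵘ.* (+ 1 ℚᵘ./ d)            ≈⟨ *≡* (cong₂ ℤ._*_ (ℤ.*-identityʳ (+ a)) (cong +_ (sym (*-identityˡ d)))) ⟩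
  + a ℚᵘ./ d                                ≈⟨ toℚᵘ-/ (+ a) d ⟨
  ℚ.toℚᵘ (+ a / d)                          ∎)
  where open ≈-Reasoning ℚᵘ.≃-setoid

-- The error term and the expected cost

errorBound : ℕ → ℕ
errorBound n = (2 + ⌊log₂ n ⌋) * n

error : Sequence
error n = + errorBound n / 1

error/n²→0 : TendsToZero (error /n²)
error/n²→0 (ℚ.mkℚ ℤ.-[1+ _ ] _ _) (ℚ.*<* ())
error/n²→0 (ℚ.mkℚ (+ zero)   _ _) (ℚ.*<* (ℤ.+<+ ()))
-- A positive fraction p/d is at least 1/d, so a threshold depending on the denominator alone
-- suffices.
error/n²→0 ε@(ℚ.mkℚ (+ p@(suc p-1)) d-1 _) _ = suc (9 * (d * d)) , bound
  where
  open ≤-Reasoning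
  d = suc d-1
  bound : (n : ℕ) → .{{_ : NonZero n}} → 9 * (d * d) < n → ℚ.∣ (error /n²) n ∣ ℚ.< ε
  bound n 9d²<n
    rewrite a/1*1/d≡a/d (errorBound n) (n * n) {{m*n≢0 n n}}
          | ℚ.0≤p⇒∣p∣≡p (ℚ.nonNegative⁻¹ (_/_ (+ errorBound n) (n * n) {{m*n≢0 n n}})
                           {{ℚ.normalize-nonNeg (errorBound n) (n * n) {{m*n≢0 n n}}}})
    = subst (_/_ (+ errorBound n) (n * n) {{m*n≢0 n n}} ℚ.<_) (ℚ.↥p/↧p≡p ε)
      (/-mono-< (errorBound n) (n * n) p d {{m*n≢0 n n}} (begin-strict
    l * n * d       ≡⟨ rotate l n d ⟩
    n * (l * d)     <⟨ *-monoʳ-< n (2+⌊log₂⌋-sublinear d n 9d²<n) ⟩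
    n * n           ≤⟨ m≤n*m (n * n) p ⟩
    p * (n * n)     ∎))
    where
    l = 2 + ⌊log₂ n ⌋
    rotate : ∀ l n d → l * n * d ≡ n * (l * d)
    rotate = solve-∀

-- `errorBound n` is `labellingBits n` plus a further `n`, and that `n` absorbs the 1 lost in
-- rounding n²/4.
n²≤4*[quarter∸bits+error] : ∀ n .{{_ : NonZero n}} →
  n * n ≤ 4 * (quarter n ∸ labellingBits n + errorBound n)
n²≤4*[quarter∸bits+error] n@(suc _) = begin
  n * n                                      ≤⟨ n²≤4*quarter+1 n ⟩
  4 * quarter n + 1                          ≤⟨ +-mono-≤ (*-monoʳ-≤ 4 (m≤n+m∸n (quarter n) (labellingBits n))) (s≤s z≤n) ⟩
  4 * (labellingBits n + k) + 4 * n          ≡⟨ regroup (labellingBits n) k n ⟩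
  4 * (k + errorBound n)                     ∎
  where
  open ≤-Reasoning
  k = quarter n ∸ labellingBits n
  regroup : ∀ b k n → 4 * (b + k) + 4 * n ≡ 4 * (k + (n + b))
  regroup = solve-∀

mainTheorem1 : Σ[ g ∈ Sequence ]
    TendsToZero (g /n²) ×
    ((φ : PosetLearningAlgorithm) (n : ℕ) .{{_ : NonZero n}} →
    expectedCost φ n ≥ (+ (n * n)) / 4 - g n)
mainTheorem1 = error , error/n²→0 , λ φ n → bound φ n
  where
  open ℚ.≤-Reasoning
  bound : (φ : PosetLearningAlgorithm) (n : ℕ) .{{_ : NonZero n}} →
          expectedCost φ n ≥ (+ (n * n)) / 4 - error n
  bound φ n = begin
    + (n * n) / 4 - error n                    ≤⟨ ℚ.+-monoˡ-≤ (ℚ.- error n) (/-mono-≤ (n * n) 4 (k + errorBound n) 1 n²*1≤) ⟩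
    + (k + errorBound n) / 1 - error n         ≡⟨ cong (_- error n) (/1-homo-+ k (errorBound n)) ⟩
    + k / 1 ℚ.+ error n - error n              ≡⟨ ℚ.+-assoc (+ k / 1) (error n) (ℚ.- error n) ⟩
    + k / 1 ℚ.+ (error n - error n)            ≡⟨ cong (+ k / 1 ℚ.+_) (ℚ.+-inverseʳ (error n)) ⟩
    + k / 1 ℚ.+ ℚ.0ℚ                           ≡⟨ ℚ.+-identityʳ (+ k / 1) ⟩
    -- Dividing the bound on the total cost by the number of posets gives the average.
    + k / 1                                    ≤⟨ /-mono-≤ k 1 σ N {{_}} {{∣posets∣-nonZero n}} kN≤σ*1 ⟩
    expectedCost φ n                           ∎
    where
    k = quarter n ∸ labellingBits n
    N = length (posets n)
    σ = sum (map (cost φ n) (posets n))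

    n²*1≤ : n * n * 1 ≤ (k + errorBound n) * 4
    n²*1≤ = subst₂ _≤_ (sym (*-identityʳ (n * n))) (*-comm 4 (k + errorBound n)) (n²≤4*[quarter∸bits+error] n)

    kN≤σ*1 : k * N ≤ σ * 1
    kN≤σ*1 = subst (k * N ≤_) (sym (*-identityʳ σ)) (totalCost≥quarter∸bits (φ n))
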